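{- For every $n\geq 0$, the poset $(\mathscr{D}_n,\leq)$ of Dyck paths of size $n$ with the dexter order is a meet-semilattice: any two elements have a greatest lower bound.
   Context: A Dyck path of size $n\geq 0$ is a word of length $2n$ in the letters $0,1$ with $n$ letters $1$ and $n$ letters $0$ such that every prefix contains at least as many $1$'s as $0$'s (the height after a prefix is its number of $1$'s minus its number of $0$'s). Let $\mathscr{D}_n$ be the set of Dyck paths of size $n$. A subpath of a Dyck path $w$ is a non-empty sequence $x$ of consecutive letters of $w$ that starts and ends at the same height and stays strictly above that height in between. A subpath $x$ is movable in $w$ if it is immediately preceded in $w$ by the letter $0$ and either $x$ ends at the last letter of $w$ or $x$ is immediately followed in $w$ by the letter $1$. For a movable subpath $x$, let $N=N(w,x)\geq 1$ be the number of consecutive letters $0$ just before $x$, so $w=a\,0^{N}\,x\,b$ where $a$ does not end with $0$; for $1\leq i\leq N$ let $M(w,x,i)=a\,0^{N-i}\,x\,0^{i}\,b\in\mathscr{D}_n$. Let $\Gamma_n$ be the directed graph on $\mathscr{D}_n$ with edges $w\to M(w,x,i)$ for all movable $x$ in $w$ and all $1\leq i\leq N(w,x)$. The dexter order is: $u\leq v$ if and only if there is a directed path (possibly of length $0$) from $u$ to $v$ in $\Gamma_n$. This is a partial order whose cover relations are exactly the edges of $\Gamma_n$. -}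

module Defs where

open import Data.Integer.Base as ℤ using (ℤ; _⊖_)
open import Data.List.Base
  using (List; []; _∷_; _++_; _∷ʳ_; replicate; inits; filter; length)
open import Data.List.Relation.Unary.All as All using (All)
open import Data.Nat.Base using (ℕ; _∸_; _≤_)
open import Data.Nat.Properties using (≡-irrelevant; ≤-irrelevant)
open import Data.Product.Base using (∃-syntax)
open import Data.Sum.Base using (_⊎_)
open import Relation.Binary.Construct.Closure.ReflexiveTransitive using (Star)
open import Relation.Binary.Definitions using (DecidableEquality)
open import Relation.Binary.PropositionalEquality
  using (_≡_; _≢_; refl)
open import Relation.Nullary.Decidable.Core using (yes; no)
open import Relation.Nullary.Negation.Core using (¬_)

data Letter : Set where
  𝟎 𝟏 : Letter

_≟_ : DecidableEquality Letter
𝟎 ≟ 𝟎 = yes refl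
𝟎 ≟ 𝟏 = no λ ()
𝟏 ≟ 𝟎 = no λ ()
𝟏 ≟ 𝟏 = yes refl

Word : Set
Word = List Letter

#_ : Letter → Word → ℕ
(# l) w = length (filter (l ≟_) w)

-- The height reached after reading a prefix.  Integer-valued, so that it is
-- the true difference on all words, not only on prefixes of Dyck paths.
height : Word → ℤ
height u = (# 𝟏) u ⊖ (# 𝟎) u

-- The length 2n is implied by the two letter counts.
record DyckPath (n : ℕ) : Set where
  constructor dyckPath
  field
    word     : Word
    ones     : (# 𝟏) word ≡ n
    zeros    : (# 𝟎) word ≡ n
    prefixes : All (λ u → (# 𝟎) u ≤ (# 𝟏) u) (inits word)

open DyckPath public using (word)

-- The conditions are proof-irrelevant, so propositional equality of Dyck
-- paths is equality of the underlying words.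
word-injective : ∀ {n} {v w : DyckPath n} → word v ≡ word w → v ≡ w
word-injective {v = dyckPath u o z p} {dyckPath .u o′ z′ p′} refl
  with refl ← ≡-irrelevant o o′ | refl ← ≡-irrelevant z z′
     | refl ← All.irrelevant ≤-irrelevant p p′ = refl

EndsWith : Letter → Word → Set
EndsWith l u = ∃[ u′ ] u ≡ u′ ∷ʳ l

StartsWith : Letter → Word → Set
StartsWith l u = ∃[ u′ ] u ≡ l ∷ u′

-- A subpath of w is an occurrence of a factor, i.e. a decomposition
-- w = p x s, since the same word x may occur several times in w.
record Subpath (w p x s : Word) : Set where
  field
    factor   : w ≡ p ++ x ++ s
    nonEmpty : x ≢ []
    returns  : height (p ++ x) ≡ height p
    above    : ∀ {y z} → x ≡ y ++ z → y ≢ [] → z ≢ [] →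
               height p ℤ.< height (p ++ y)

record Movable (w p x s : Word) : Set where
  field
    subpath  : Subpath w p x s
    preceded : EndsWith 𝟎 p
    followed : s ≡ [] ⊎ StartsWith 𝟏 s

-- Since a does not end with 𝟎, N is the number of consecutive 𝟎's just
-- before x; N ≥ 1 because x is movable.
data _⟶_ {n : ℕ} (w v : DyckPath n) : Set where
  move : ∀ {a x b : Word} (N i : ℕ) →
         Movable (word w) (a ++ replicate N 𝟎) x b →
         ¬ EndsWith 𝟎 a →
         1 ≤ i → i ≤ N →
         word v ≡ a ++ replicate (N ∸ i) 𝟎 ++ x ++ replicate i 𝟎 ++ b →
         w ⟶ v

_≤ᴰ_ : ∀ {n} → DyckPath n → DyckPath n → Set
_≤ᴰ_ = Star _⟶_

{-# OPTIONS --safe #-}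

-- Code a Dyck path by the function g sending r to the number of letters 𝟏
-- right of the 𝟎 matched with the 𝟏 that has r letters 𝟏 to its right.  The
-- codes are the g with g r ≤ r and g r ≤ g s whenever g r ≤ s < r.  Going down
-- an edge of Γ picks an entry q and replaces g r by q + 1 at all r > q with
-- g r = g q.  Hence u lies below v iff v r ≤ u r for all r, and u r = u s
-- whenever u r ≤ s < r and v r = v s: if u is strictly below v and r is the
-- first index where they differ, then picking the last q < u r with v q = v r
-- gives a lower neighbour of v that is still above u.  In this description the
-- meet of u and v is found greedily, index by index, taking at r the least
-- value allowed by the values already chosen.
module Submission where

open import Defs hiding (_≟_)
open import Algebra.Bundles using (AbelianGroup)
open import Data.Integer.Base as ℤ using (ℤ; _⊖_; 0ℤ)
import Data.Integer.Properties as ℤ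
open import Data.Integer.Tactic.RingSolver using (solve-∀)
open import Algebra.Properties.Group (AbelianGroup.group ℤ.+-0-abelianGroup) using (∙-cancelˡ)
open import Data.List.Base
  using (List; []; _∷_; _++_; _∷ʳ_; length; map; filter; replicate; inits; initLast; _∷ʳ′_)
open import Data.List.Membership.Propositional using (_∈_)
open import Data.List.Properties
  using (length-map; length-++; ++-assoc; ++-identityʳ; map-++; map-replicate; map-id-local;
         ∷-injectiveʳ; filter-++)
open import Data.List.Relation.Unary.All as All using (All; []; _∷_)
open import Data.List.Relation.Unary.All.Properties using (map⁺; map⁻)
open import Data.List.Relation.Unary.AllPairs using (AllPairs; []; _∷_)
open import Data.List.Relation.Unary.Any using (here; there)
open import Data.Nat.Base
open import Data.Nat.Induction using (<-rec; <-wellFounded)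
open import Data.Nat.Properties
open import Data.Product.Base hiding (map)
open import Data.Sum.Base using (_⊎_; inj₁; inj₂)
open import Function.Base using (_∘_; case_of_)
open import Induction.WellFounded using (Acc; acc)
open import Level using (0ℓ)
open import Relation.Binary.Construct.Closure.ReflexiveTransitive using (ε; _◅_; _◅◅_)
open import Relation.Binary.Definitions using (tri<; tri≈; tri>)
open import Relation.Binary.Lattice using (IsMeetSemilattice)
open import Relation.Binary.PropositionalEquality
open import Relation.Nullary using (¬_; Dec; yes; no; contradiction)
open import Relation.Nullary.Decidable using (_×-dec_; _⊎-dec_; _→-dec_; decidable-stable)
open import Relation.Unary using (Pred; Decidable)

-- The order on codes

record IsCode (g : ℕ → ℕ) : Set where
  field
    bounded : ∀ r → g r ≤ r
    nested  : ∀ {r s} → s < r → g r ≤ s → g r ≤ g s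

record _⊑_ (u v : ℕ → ℕ) : Set where
  field
    below  : ∀ r → v r ≤ u r
    linked : ∀ {r s} → s < r → u r ≤ s → v r ≡ v s → u r ≡ u s

open IsCode
open _⊑_

⊑-reflexive : ∀ {u v} → (∀ r → u r ≡ v r) → u ⊑ v
⊑-reflexive eq .below r = ≤-reflexive (sym (eq r))
⊑-reflexive eq .linked {r} {s} _ _ e = trans (eq r) (trans e (sym (eq s)))

⊑-trans : ∀ {u v w} → u ⊑ v → v ⊑ w → u ⊑ w
⊑-trans p q .below r = ≤-trans (below q r) (below p r)
⊑-trans p q .linked {r} s<r ur≤s e =
  linked p s<r ur≤s (linked q s<r (≤-trans (below p r) ur≤s) e)

⊑-antisym : ∀ {u v} → u ⊑ v → v ⊑ u → ∀ r → u r ≡ v r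
⊑-antisym p q r = ≤-antisym (below q r) (below p r)

-- Bounded search for least and greatest indices

Minimal : Pred ℕ 0ℓ → Pred ℕ 0ℓ
Minimal P k = P k × (∀ {j} → j < k → ¬ P j)

minimal? : ∀ {P} → Decidable P → ∀ n → (∃[ k ] k < n × Minimal P k) ⊎ (∀ {j} → j < n → ¬ P j)
minimal? P? zero = inj₂ λ ()
minimal? P? (suc n) with minimal? P? n
... | inj₁ (k , k<n , m) = inj₁ (k , m<n⇒m<1+n k<n , m)
... | inj₂ none with P? n
...   | yes p = inj₁ (n , ≤-refl , p , none)
...   | no ¬p = inj₂ λ j<1+n → case m≤n⇒m<n∨m≡n (s≤s⁻¹ j<1+n) of λ where
        (inj₁ j<n) → none j<n
        (inj₂ refl) → ¬p

maximal : ∀ {P : Pred ℕ 0ℓ} → Decidable P → ∀ {n i} → i < n → P i →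
          ∃[ k ] k < n × P k × (∀ {j} → k < j → j < n → ¬ P j)
maximal P? {suc n} i<1+n pi with P? n
... | yes p = n , ≤-refl , p , λ n<j j<1+n → contradiction (≤-trans j<1+n n<j) 1+n≰n
... | no ¬p with m≤n⇒m<n∨m≡n (s≤s⁻¹ i<1+n)
...   | inj₂ refl = contradiction pi ¬p
...   | inj₁ i<n with maximal P? i<n pi
...     | k , k<n , pk , max = k , m<n⇒m<1+n k<n , pk , λ k<j j<1+n →
            case m≤n⇒m<n∨m≡n (s≤s⁻¹ j<1+n) of λ where
              (inj₁ j<n) → max k<j j<n
              (inj₂ refl) → ¬p

-- `nested` applies at `s = g r` as soon as `g r < r`. So every value of a code occurs at its own
-- index, which is what gets the search for a pivot started.
idempotent : ∀ {g} → IsCode g → ∀ r → g (g r) ≡ g r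
idempotent {g} c r with m≤n⇒m<n∨m≡n (bounded c r)
... | inj₂ eq  = cong g eq
... | inj₁ lt  = ≤-antisym (bounded c (g r)) (nested c lt ≤-refl)

-- Single lowering steps on codes

record Drop (q : ℕ) (u u′ : ℕ → ℕ) : Set where
  field
    linked-ups : ∀ {r} → q < r → u r ≡ u q → u′ r ≡ suc q
    other-ups  : ∀ {r} → ¬ (q < r × u r ≡ u q) → u′ r ≡ u r

affected? : ∀ q (u : ℕ → ℕ) r → Dec (q < r × u r ≡ u q)
affected? q u r = (q <? r) ×-dec (u r ≟ u q)

module _ {q : ℕ} {u u′ : ℕ → ℕ} (d : Drop q u u′) where
  open Drop d

  drop-⊑ : IsCode u → u′ ⊑ u
  drop-⊑ c .below r with affected? q u r
  ... | yes (q<r , e) =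
        subst₂ _≤_ (sym e) (sym (linked-ups q<r e)) (m≤n⇒m≤1+n (bounded c q))
  ... | no ¬a = ≤-reflexive (sym (other-ups ¬a))
  drop-⊑ c .linked {r} {s} s<r u′r≤s ur≡us with affected? q u r | affected? q u s
  -- `u′ r ≤ s` gives `q < s`, and `u s ≡ u r ≡ u q`, so `s` would be affected as well.
  ... | yes (q<r , e) | no ¬b =
        contradiction (subst (_≤ s) (linked-ups q<r e) u′r≤s , trans (sym ur≡us) e) ¬b
  ... | no ¬a | yes (q<s , f) = contradiction (<-trans q<s s<r , trans ur≡us f) ¬a
  ... | yes (q<r , e) | yes (q<s , f) = trans (linked-ups q<r e) (sym (linked-ups q<s f))
  ... | no ¬a | no ¬b = trans (other-ups ¬a) (trans ur≡us (sym (other-ups ¬b)))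

module _ {w u : ℕ → ℕ} (cw : IsCode w) (cu : IsCode u) (w⊑u : w ⊑ u)
         {r : ℕ} (agree : ∀ {s} → s < r → w s ≡ u s) (ur<wr : u r < w r) where

  private
    r-linked : ∃[ q ] q < w r × u q ≡ u r × (∀ {j} → q < j → j < w r → ¬ u j ≡ u r)
    -- The index `u r` is a candidate: it lies below `w r`, and `u` takes the value `u r` there by
    -- `idempotent`.
    r-linked = maximal (λ q → u q ≟ u r) ur<wr (idempotent cu r)

  pivot : ℕ
  pivot = proj₁ r-linked

  pivot<r : pivot < r
  pivot<r = ≤-trans (proj₁ (proj₂ r-linked)) (bounded cw r)

  pivot-linked : u r ≡ u pivot
  pivot-linked = sym (proj₁ (proj₂ (proj₂ r-linked)))

  -- Lowering at the pivot does not overshoot `w`: every index raised to `suc q` already has a value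
  -- of `w` above `q`.
  drop-lower : ∀ {u′} → Drop pivot u u′ → w ⊑ u′
  drop-lower {u′} d = record { below = below′ ; linked = linked′ }
    where
    open Drop d
    q = pivot
    q<wr : q < w r
    q<wr = proj₁ (proj₂ r-linked)

    1+q≢ur : ∀ {k} → u q ≡ k → ¬ suc q ≤ k
    1+q≢ur refl 1+q≤k = 1+n≰n (≤-trans 1+q≤k (bounded cu q))

    -- At `r` this is the choice of the pivot. Right of `r`, `w t` exceeds `r` or is linked to
    -- `w r`. Left of `r`, `t < w r` contradicts maximality of the pivot, and `w r ≤ t` would link
    -- `r` to `t` in `w`, forcing `w r ≡ w t ≡ u t ≡ u r`.
    pushed : ∀ {t} → q < t → u t ≡ u q → q < w t
    pushed {t} q<t e with <-cmp t r
    ... | tri≈ _ refl _ = q<wr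
    ... | tri> _ _ r<t with w t ≤? r
    ...   | yes wt≤r = subst (q <_) (sym (linked w⊑u r<t wt≤r (trans e (sym pivot-linked)))) q<wr
    ...   | no wt≰r = <-trans pivot<r (≰⇒> wt≰r)
    pushed {t} q<t e | tri< t<r _ _ with t <? w r
    ... | yes t<wr = contradiction (trans e (sym pivot-linked))
                       (proj₂ (proj₂ (proj₂ r-linked)) q<t t<wr)
    ... | no t≮wr = contradiction
          (trans (linked w⊑u t<r (≮⇒≥ t≮wr) (trans pivot-linked (sym e)))
                 (trans (agree t<r) (trans e (sym pivot-linked))))
          (>⇒≢ ur<wr)

    below′ : ∀ t → u′ t ≤ w t
    below′ t with affected? q u t
    ... | yes (q<t , e) = subst (_≤ w t) (sym (linked-ups q<t e)) (pushed q<t e)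
    ... | no ¬a = subst (_≤ w t) (sym (other-ups ¬a)) (below w⊑u t)

    linked′ : ∀ {t s} → s < t → w t ≤ s → u′ t ≡ u′ s → w t ≡ w s
    linked′ {t} {s} s<t wt≤s eq with affected? q u t | affected? q u s
    ... | no ¬a | no ¬b =
          linked w⊑u s<t wt≤s (trans (sym (other-ups ¬a)) (trans eq (other-ups ¬b)))
    ... | yes (_ , e) | yes (_ , f) = linked w⊑u s<t wt≤s (trans e (sym f))
    ... | no ¬a | yes (q<s , f) =
          contradiction (subst (_≤ u s) ut≡1+q (nested cu s<t (≤-trans (below w⊑u t) wt≤s)))
                        (1+q≢ur (sym f))
      where
      ut≡1+q : u t ≡ suc q
      ut≡1+q = trans (sym (other-ups ¬a)) (trans eq (linked-ups q<s f))
    ... | yes (q<t , e) | no ¬b with <-cmp s r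
    -- Before `r` the codes agree, so `w s ≡ suc q`, and `pushed` supplies the inequality opposite
    -- to nesting.
    ...   | tri< s<r _ _ =
            ≤-antisym (nested cw s<t wt≤s)
                      (subst (_≤ w t) (trans (sym us≡1+q) (sym (agree s<r))) (pushed q<t e))
      where
      us≡1+q : u s ≡ suc q
      us≡1+q = trans (sym (other-ups ¬b)) (trans (sym eq) (linked-ups q<t e))
    ...   | tri≈ _ refl _ = contradiction (pivot<r , pivot-linked) ¬b
    -- Since `u s ≡ suc q ≤ r`, nesting gives `suc q ≤ u r ≡ u q`, against `u q ≤ q`.
    ...   | tri> _ _ r<s =
            contradiction (subst (_≤ u r) us≡1+q
                             (nested cu r<s (subst (_≤ r) (sym us≡1+q) pivot<r)))
                          (1+q≢ur (sym pivot-linked))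
      where
      us≡1+q : u s ≡ suc q
      us≡1+q = trans (sym (other-ups ¬b)) (trans (sym eq) (linked-ups q<t e))

-- The greedy meet of two codes

Tied : (u v : ℕ → ℕ) → ℕ → ℕ → Set
Tied u v r s = u r ≡ u s ⊎ v r ≡ v s

-- `≤r` and `nest` are the code conditions at `r`; the other fields express `w ⊑ u` and `w ⊑ v`
-- there. Only values of `w` before `r` occur, so `w` can be built by recursion.
record Admissible (u v w : ℕ → ℕ) (r z : ℕ) : Set where
  constructor admissible
  field
    ≥u    : u r ≤ z
    ≥v    : v r ≤ z
    ≤r    : z ≤ r
    nest  : ∀ {s} → s < r → z ≤ s → z ≤ w s
    tie   : ∀ {s} → s < r → z ≤ s → Tied u v r s → z ≡ w s

open Admissible

IsGreedy : (u v w : ℕ → ℕ) → Set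
IsGreedy u v w = ∀ r → Minimal (Admissible u v w r) (w r)

module Greedy {u v w : ℕ → ℕ} (cu : IsCode u) (cv : IsCode v) (greedy : IsGreedy u v w) where

  isCode : IsCode w
  isCode .bounded r = ≤r (proj₁ (greedy r))
  isCode .nested {r} = nest (proj₁ (greedy r))

  ⊑-left : w ⊑ u
  ⊑-left .below r = ≥u (proj₁ (greedy r))
  ⊑-left .linked {r} s<r wr≤s e = tie (proj₁ (greedy r)) s<r wr≤s (inj₁ e)

  ⊑-right : w ⊑ v
  ⊑-right .below r = ≥v (proj₁ (greedy r))
  ⊑-right .linked {r} s<r wr≤s e = tie (proj₁ (greedy r)) s<r wr≤s (inj₂ e)

  module _ {x : ℕ → ℕ} (x⊑u : x ⊑ u) (x⊑v : x ⊑ v) (cx : IsCode x) where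

    -- The content of `x ⊑ w` at the single index `r`, the form suited to strong induction.
    Dominated : ℕ → Set
    Dominated r = w r ≤ x r × (∀ {s} → s < r → x r ≤ s → w r ≡ w s → x r ≡ x s)

    private
      module Step {r : ℕ} (ih : ∀ {s} → s < r → Dominated s) where

        -- The least value of w on [x r, r) is admissible at r.
        module Above {p : ℕ} (p<r : p < r) (xr≤p : x r ≤ p)
                 (least : ∀ {s} → s < r → x r ≤ s → w p ≤ w s) (wp≤xr : w p ≤ x r) where

          ≥t : ∀ {t} → IsCode t → x ⊑ t → w ⊑ t → t r ≤ w p
          ≥t ct x⊑t w⊑t =
            ≤-trans (nested ct p<r (≤-trans (below x⊑t r) xr≤p)) (below w⊑t p)

          tie-t : ∀ {t s} → IsCode t → x ⊑ t → w ⊑ t → s < r → w p ≤ s → t r ≡ t s → w p ≡ w s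
          tie-t {t} {s} ct x⊑t w⊑t s<r wp≤s e with <-cmp p s
          ... | tri≈ _ refl _ = refl
          ... | tri< p<s _ _ = ≤-antisym (least s<r xr≤s) (nested isCode p<s ws≤p)
            where
            xr≤s = ≤-trans xr≤p (<⇒≤ p<s)
            -- `x` links `r` to `s`, so the induction hypothesis gives `w s ≤ x s ≡ x r ≤ p`.
            ws≤p : w s ≤ p
            ws≤p = ≤-trans (proj₁ (ih s<r))
                     (subst (_≤ p) (linked x⊑t s<r xr≤s e) xr≤p)
          ... | tri> _ _ s<p = linked w⊑t s<p wp≤s
                  (≤-antisym (nested ct s<p (≤-trans (below w⊑t p) wp≤s))
                             (subst (_≤ t p) e (nested ct p<r (≤-trans (below x⊑t r) xr≤p))))

          ok : Admissible u v w r (w p)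
          ok .≥u = ≥t cu x⊑u ⊑-left
          ok .≥v = ≥t cv x⊑v ⊑-right
          ok .≤r = ≤-trans wp≤xr (bounded cx r)
          ok .nest {s} s<r wp≤s with x r ≤? s
          ... | yes xr≤s = least s<r xr≤s
          ... | no xr≰s = nested isCode (<-≤-trans (≰⇒> xr≰s) xr≤p) wp≤s
          ok .tie s<r wp≤s (inj₁ e) = tie-t cu x⊑u ⊑-left s<r wp≤s e
          ok .tie s<r wp≤s (inj₂ e) = tie-t cv x⊑v ⊑-right s<r wp≤s e

        least-value : ∀ {k} m → k < m →
                      ∃[ p ] p < m × k ≤ p × (∀ {s} → s < m → k ≤ s → w p ≤ w s)
        least-value {k} (suc m) k<1+m with m≤n⇒m<n∨m≡n (s≤s⁻¹ k<1+m)
        ... | inj₂ refl = m , ≤-refl , ≤-refl , λ s<1+m m≤s →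
                ≤-reflexive (cong w (≤-antisym m≤s (s≤s⁻¹ s<1+m)))
        ... | inj₁ k<m with least-value m k<m
        ...   | p , p<m , k≤p , least with w p ≤? w m
        ...     | yes wp≤wm = p , m<n⇒m<1+n p<m , k≤p , λ s<1+m k≤s →
                    case m≤n⇒m<n∨m≡n (s≤s⁻¹ s<1+m) of λ where
                      (inj₁ s<m) → least s<m k≤s
                      (inj₂ refl) → wp≤wm
        ...     | no wp≰wm = m , ≤-refl , <⇒≤ k<m , λ s<1+m k≤s →
                    case m≤n⇒m<n∨m≡n (s≤s⁻¹ s<1+m) of λ where
                      (inj₁ s<m) → ≤-trans (<⇒≤ (≰⇒> wp≰wm)) (least s<m k≤s)
                      (inj₂ refl) → ≤-refl

        -- For `x r < r`, the least value `w p` on [x r, r) is admissible and at most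
        -- `w (x r) ≤ x r`; minimality of `w r` gives `w r ≤ w p`.
        dominates : w r ≤ x r
        dominates with m≤n⇒m<n∨m≡n (bounded cx r)
        ... | inj₂ xr≡r = subst (w r ≤_) (sym xr≡r) (bounded isCode r)
        ... | inj₁ xr<r with least-value r xr<r
        ...   | p , p<r , xr≤p , least = ≤-trans (≮⇒≥ not-smaller) wp≤xr
          where
          wp≤xr = ≤-trans (least xr<r ≤-refl) (bounded isCode (x r))
          not-smaller : ¬ w p < w r
          not-smaller wp<wr =
            proj₂ (greedy r) wp<wr (Above.ok p<r xr≤p least wp≤xr)

        module _ {s : ℕ} (s<r : s < r) (xr≤s : x r ≤ s) (wr≡ws : w r ≡ w s) where

          -- If w r is a value of u or v at r, then s is tied to r; otherwise
          -- w (w r - 1) would be admissible at r unless x r ≡ x s.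
          attained : ∀ {t} → IsCode t → x ⊑ t → w ⊑ t → w r ≤ t r → x r ≡ x s
          attained {t} ct x⊑t w⊑t wr≤tr = linked x⊑t s<r xr≤s
            (≤-antisym (nested ct s<r (≤-trans (below x⊑t r) xr≤s))
                       (≤-trans (below w⊑t s) (subst (_≤ t r) wr≡ws wr≤tr)))

          -- A tie of `r` to `p` is carried over to `s`. If `s < p`, then `x` links `r` to `p`, and
          -- the induction hypothesis at `p` links `p` to `s`. If `p < s`, nesting squeezes `t s`
          -- between `t r` and `t p`.
          via-tie : ∀ {t p} → IsCode t → x ⊑ t → w ⊑ t →
                    p < r → w r ≤ p → t r ≡ t p → x r ≡ x s
          via-tie {t} {p} ct x⊑t w⊑t p<r wr≤p e with <-cmp p s
          ... | tri≈ _ refl _ = linked x⊑t s<r xr≤s e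
          ... | tri> _ _ s<p = trans xr≡xp
                  (proj₂ (ih p<r) s<p (subst (_≤ s) xr≡xp xr≤s)
                    (trans (sym (linked w⊑t p<r wr≤p e)) wr≡ws))
            where
            xr≡xp : x r ≡ x p
            xr≡xp = linked x⊑t p<r (≤-trans xr≤s (<⇒≤ s<p)) e
          ... | tri< p<s _ _ = linked x⊑t s<r xr≤s
                  (≤-antisym (nested ct s<r (≤-trans (below x⊑t r) xr≤s))
                    (subst (t s ≤_) (sym e) (nested ct p<s
                      (≤-trans (below w⊑t s) (subst (_≤ p) wr≡ws wr≤p)))))

          module Candidate {j : ℕ} (wr≡1+j : w r ≡ suc j) (ur≤j : u r ≤ j) (vr≤j : v r ≤ j)
                           (xr≢xs : ¬ x r ≡ x s) where

            j<r : j < r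
            j<r = subst (_≤ r) wr≡1+j (bounded isCode r)

            tie-t : ∀ {t p} → IsCode t → x ⊑ t → w ⊑ t → t r ≤ j →
                    p < r → w j ≤ p → t r ≡ t p → w j ≡ w p
            tie-t {t} {p} ct x⊑t w⊑t tr≤j p<r wj≤p e with <-cmp j p
            ... | tri≈ _ refl _ = refl
            -- Here `w r ≡ suc j ≤ p`, so `via-tie` yields the excluded link.
            ... | tri< j<p _ _ = contradiction
                    (via-tie ct x⊑t w⊑t p<r (subst (_≤ p) (sym wr≡1+j) j<p) e) xr≢xs
            ... | tri> _ _ p<j = linked w⊑t p<j wj≤p
                    (≤-antisym (nested ct p<j (≤-trans (below w⊑t j) wj≤p))
                               (subst (_≤ t j) e (nested ct j<r tr≤j)))

            ok : Admissible u v w r (w j)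
            ok .≥u = ≤-trans (nested cu j<r ur≤j) (below ⊑-left j)
            ok .≥v = ≤-trans (nested cv j<r vr≤j) (below ⊑-right j)
            ok .≤r = ≤-trans (bounded isCode j) (<⇒≤ j<r)
            ok .nest {p} p<r wj≤p with <-cmp j p
            ... | tri≈ _ refl _ = ≤-refl
            ... | tri> _ _ p<j = nested isCode p<j wj≤p
            ... | tri< j<p _ _ = ≤-trans (bounded isCode j) (≤-trans (n≤1+n j)
                    (subst (_≤ w p) wr≡1+j
                      (nested isCode p<r (subst (_≤ p) (sym wr≡1+j) j<p))))
            ok .tie p<r wj≤p (inj₁ e) = tie-t cu x⊑u ⊑-left ur≤j p<r wj≤p e
            ok .tie p<r wj≤p (inj₂ e) = tie-t cv x⊑v ⊑-right vr≤j p<r wj≤p e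

          links : x r ≡ x s
          links with w r ≤? u r | w r ≤? v r
          ... | yes wr≤ur | _ = attained cu x⊑u ⊑-left wr≤ur
          ... | no _ | yes wr≤vr = attained cv x⊑v ⊑-right wr≤vr
          ... | no wr≰ur | no wr≰vr =
            -- `u r < w r` makes `w r` a successor `suc j`; an admissible `w j ≤ j` then contradicts
            -- minimality of `w r`.
            decidable-stable (x r ≟ x s) (go (w r) refl (≰⇒> wr≰ur) (≰⇒> wr≰vr))
            where
            go : ∀ k → w r ≡ k → u r < k → v r < k → ¬ ¬ x r ≡ x s
            go (suc j) eq ur<k vr<k xr≢xs =
              proj₂ (greedy r) (subst (w j <_) (sym eq) (s≤s (bounded isCode j)))
                (Candidate.ok eq (s≤s⁻¹ ur<k) (s≤s⁻¹ vr<k) xr≢xs)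

    greatest : x ⊑ w
    greatest = record { below = λ r → proj₁ (all r) ; linked = λ {r} → proj₂ (all r) }
      where
      all : ∀ r → Dominated r
      all = <-rec Dominated λ r ih → Step.dominates ih , Step.links ih

-- Codes as lists

-- Entry r is the one with r entries to its right; beyond the list the
-- value is r, which meets all conditions on codes vacuously.
at : List ℕ → ℕ → ℕ
at []       r = r
at (z ∷ fs) r with r ≟ length fs
... | yes _ = z
... | no  _ = at fs r

at-head : ∀ z fs → at (z ∷ fs) (length fs) ≡ z
at-head z fs with length fs ≟ length fs
... | yes _ = refl
... | no ≢ = contradiction refl ≢

at-tail : ∀ {z fs r} → r ≢ length fs → at (z ∷ fs) r ≡ at fs r
at-tail {fs = fs} {r} ≢ with r ≟ length fs
... | yes e = contradiction e ≢
... | no _ = refl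

at-beyond : ∀ fs {r} → length fs ≤ r → at fs r ≡ r
at-beyond [] _ = refl
at-beyond (z ∷ fs) lt = trans (at-tail (>⇒≢ lt)) (at-beyond fs (<⇒≤ lt))

at-++ : ∀ as {bs r} → r < length bs → at (as ++ bs) r ≡ at bs r
at-++ [] lt = refl
at-++ (a ∷ as) {bs} lt = trans (at-tail (<⇒≢ (≤-trans lt len))) (at-++ as lt)
  where
  len : length bs ≤ length (as ++ bs)
  len = subst (length bs ≤_) (sym (length-++ as)) (m≤n+m _ _)

length-map-++ : ∀ (φ : ℕ → ℕ) as bs → length (map φ as ++ bs) ≡ length (as ++ bs)
length-map-++ φ as bs rewrite length-++ (map φ as) {bs} | length-map φ as = sym (length-++ as)

-- The index `r` may lie beyond the list, where its value is `r` itself; there the equation holds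
-- because `φ` fixes large values.
at-map : ∀ φ as {bs r} → (∀ {z} → length bs ≤ z → φ z ≡ z) → length bs ≤ r →
         at (map φ as ++ bs) r ≡ φ (at (as ++ bs) r)
at-map φ [] {bs} fix le = trans (at-beyond bs le) (sym (trans (cong φ (at-beyond bs le)) (fix le)))
at-map φ (a ∷ as) {bs} {r} fix le with r ≟ length (map φ as ++ bs) | r ≟ length (as ++ bs)
... | yes _ | yes _ = refl
... | no _  | no _  = at-map φ as fix le
... | yes e | no ≢  = contradiction (trans e (length-map-++ φ as bs)) ≢
... | no ≢  | yes e = contradiction (trans e (sym (length-map-++ φ as bs))) ≢

at-injective : ∀ fs gs → length fs ≡ length gs → (∀ r → at fs r ≡ at gs r) → fs ≡ gs
at-injective [] [] _ _ = refl
at-injective (y ∷ fs) (z ∷ gs) len eq = cong₂ _∷_ y≡z (at-injective fs gs len′ eq′)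
  where
  len′ = suc-injective len
  y≡z : y ≡ z
  y≡z = trans (sym (at-head y fs)) (trans (eq (length fs))
          (trans (cong (at (z ∷ gs)) len′) (at-head z gs)))
  eq′ : ∀ r → at fs r ≡ at gs r
  eq′ r with r ≟ length fs
  ... | yes refl = trans (at-beyond fs ≤-refl) (sym (at-beyond gs (≤-reflexive (sym len′))))
  ... | no ≢ = trans (sym (at-tail ≢)) (trans (eq r) (at-tail (≢ ∘ λ e → trans e (sym len′))))

at-split : ∀ fs {q} → q < length fs → ∃₂ λ as bs → fs ≡ as ++ at fs q ∷ bs × length bs ≡ q
at-split (z ∷ fs) {q} q<len with q ≟ length fs
... | yes e = [] , fs , refl , sym e
... | no ≢ with at-split fs (≤∧≢⇒< (s≤s⁻¹ q<len) ≢)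
...   | as , bs , eq , len = z ∷ as , bs , cong (z ∷_) eq , len

at-∈ : ∀ as {bs r} → length bs ≤ r → r < length (as ++ bs) → at (as ++ bs) r ∈ as
at-∈ [] le lt = contradiction (≤-trans lt le) 1+n≰n
at-∈ (a ∷ as) {bs} {r} le lt with r ≟ length (as ++ bs)
... | yes _ = here refl
... | no ≢ = there (at-∈ as le (≤∧≢⇒< (s≤s⁻¹ lt) ≢))

-- Computing the greedy code

admissible? : ∀ u v w r → Decidable (Admissible u v w r)
admissible? u v w r z
  with u r ≤? z | v r ≤? z | z ≤? r
     | allUpTo? (λ s → (z ≤? s) →-dec (z ≤? w s)) r
     | allUpTo? (λ s → (z ≤? s) →-dec (((u r ≟ u s) ⊎-dec (v r ≟ v s)) →-dec (z ≟ w s))) r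
... | no ¬p | _ | _ | _ | _ = no (¬p ∘ ≥u)
... | yes _ | no ¬p | _ | _ | _ = no (¬p ∘ ≥v)
... | yes _ | yes _ | no ¬p | _ | _ = no (¬p ∘ ≤r)
... | yes _ | yes _ | yes _ | no ¬p | _ = no λ a → ¬p (nest a)
... | yes _ | yes _ | yes _ | yes _ | no ¬p = no λ a → ¬p (tie a)
... | yes p | yes q | yes b | yes n | yes t = yes (admissible p q b n t)

-- Admissibility at `r` sees only earlier entries, so prepending further entries to the list does
-- not disturb it.
admissible-resp : ∀ {u v w w′ r z} → (∀ {s} → s < r → w s ≡ w′ s) →
                  Admissible u v w r z → Admissible u v w′ r z
admissible-resp eq (admissible p q s n t) = admissible p q s
  (λ s<r z≤s → subst (_ ≤_) (eq s<r) (n s<r z≤s))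
  (λ s<r z≤s e → trans (t s<r z≤s e) (eq s<r))

minimal-resp : ∀ {u v w w′ r z} → (∀ {s} → s < r → w s ≡ w′ s) →
               Minimal (Admissible u v w r) z → Minimal (Admissible u v w′ r) z
minimal-resp eq (a , min) =
  admissible-resp eq a , λ j<z → min j<z ∘ admissible-resp (sym ∘ eq)

module _ {u v : ℕ → ℕ} (cu : IsCode u) (cv : IsCode v) where

  -- No `s` satisfies `r ≤ s < r`, so `nest` and `tie` are vacuous. Hence the greedy choice never
  -- gets stuck.
  admissible-self : ∀ w r → Admissible u v w r r
  admissible-self w r = admissible (bounded cu r) (bounded cv r) ≤-refl
    (λ s<r r≤s → contradiction (≤-trans s<r r≤s) 1+n≰n)
    (λ s<r r≤s → contradiction (≤-trans s<r r≤s) 1+n≰n)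

  next : ∀ w r → ∃ (Minimal (Admissible u v w r))
  next w r with minimal? (admissible? u v w r) (suc r)
  ... | inj₁ (z , _ , min) = z , min
  ... | inj₂ none = contradiction (admissible-self w r) (none ≤-refl)

  greedy : ℕ → List ℕ
  greedy zero    = []
  greedy (suc n) = proj₁ (next (at (greedy n)) n) ∷ greedy n

  length-greedy : ∀ n → length (greedy n) ≡ n
  length-greedy zero    = refl
  length-greedy (suc n) = cong suc (length-greedy n)

  greedy-minimal : ∀ n {r} → r < n → Minimal (Admissible u v (at (greedy n)) r) (at (greedy n) r)
  greedy-minimal (suc n) {r} r<1+n with m≤n⇒m<n∨m≡n (s≤s⁻¹ r<1+n)
  ... | inj₁ r<n = subst (Minimal _) (sym (older r<n))
          (minimal-resp (λ s<r → sym (older (<-trans s<r r<n))) (greedy-minimal n r<n))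
    where
    older : ∀ {s} → s < n → at (greedy (suc n)) s ≡ at (greedy n) s
    older s<n = at-tail (subst (_ ≢_) (sym (length-greedy n)) (<⇒≢ s<n))
  ... | inj₂ refl = subst (Minimal _) (sym newest)
          (minimal-resp (λ s<n → sym (at-tail (subst (_ ≢_) (sym (length-greedy n)) (<⇒≢ s<n))))
            (proj₂ (next (at (greedy n)) n)))
    where
    newest : at (greedy (suc n)) n ≡ proj₁ (next (at (greedy n)) n)
    newest = trans (cong (at (greedy (suc n))) (sym (length-greedy n))) (at-head _ (greedy n))

  greedy-isGreedy : ∀ n → (∀ {r} → n ≤ r → u r ≡ r) → IsGreedy u v (at (greedy n))
  greedy-isGreedy n trivial r with r <? n
  ... | yes r<n = greedy-minimal n r<n
  -- From `n` on, `u r ≡ r ≤ z ≤ r` leaves only `r`, which is the default value of `at`.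
  ... | no r≮n = subst (Minimal _)
        (sym (at-beyond (greedy n) (subst (_≤ r) (sym (length-greedy n)) (≮⇒≥ r≮n))))
        ( admissible-self _ r
        , λ j<r a → contradiction (≤-trans j<r (subst (_≤ _) (trivial (≮⇒≥ r≮n)) (≥u a))) 1+n≰n)

-- Words and codes

-- Reading a word from right to left: Run L s w f t starts with L letters 𝟏
-- already read and a stack s of pending letters 𝟎, each recorded as the
-- number of letters 𝟏 to its right.  Every 𝟏 pops the 𝟎 it matches; f lists
-- the popped values and t is the final stack.
data Run (L : ℕ) (s : List ℕ) : Word → List ℕ → List ℕ → Set where
  done : Run L s [] [] s
  zero : ∀ {w f t} → Run L s w f t → Run L s (𝟎 ∷ w) f (L + length f ∷ t)
  one  : ∀ {w f t z} → Run L s w f (z ∷ t) → Run L s (𝟏 ∷ w) (z ∷ f) t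

run-deterministic : ∀ {L s w f f′ t t′} → Run L s w f t → Run L s w f′ t′ → f ≡ f′ × t ≡ t′
run-deterministic done done = refl , refl
run-deterministic (zero r) (zero r′) with refl , refl ← run-deterministic r r′ = refl , refl
run-deterministic (one r) (one r′) with refl , refl ← run-deterministic r r′ = refl , refl

base-++ : ∀ L (f g : List ℕ) → L + length (f ++ g) ≡ L + length g + length f
base-++ L f g = trans (cong (L +_) (trans (length-++ f) (+-comm (length f) _)))
                      (sym (+-assoc L _ _))

run-++ : ∀ {L s a b f g t t′} → Run L s b g t → Run (L + length g) t a f t′ →
         Run L s (a ++ b) (f ++ g) t′
run-++ r done = r
run-++ {L} {s} {b = b} {g = g} r (zero {w} {f} {t} r′) =
  subst (λ k → Run L s (𝟎 ∷ w ++ b) (f ++ g) (k ∷ t)) (base-++ L f g) (zero (run-++ r r′))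
run-++ r (one r′) = one (run-++ r r′)

run-split : ∀ {L s} a {b h t′} → Run L s (a ++ b) h t′ →
            ∃[ f ] ∃[ g ] ∃[ t ] h ≡ f ++ g × Run L s b g t × Run (L + length g) t a f t′
run-split [] r = [] , _ , _ , refl , r , done
run-split {L} (𝟎 ∷ a) (zero {t = t′} r) with run-split a r
... | f , g , t , refl , rb , ra = f , g , t , refl , rb ,
      subst (λ k → Run (L + length g) t (𝟎 ∷ a) f (k ∷ t′)) (sym (base-++ L f g)) (zero ra)
run-split (𝟏 ∷ a) (one {z = z} r) with run-split a r
... | f , g , t , refl , rb , ra = z ∷ f , g , t , refl , rb , one ra

run-lift : ∀ {L w f t} s → Run L [] w f t → Run L s w f (t ++ s)
run-lift s done = done
run-lift s (zero r) = zero (run-lift s r)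
run-lift s (one r) = one (run-lift s r)

-- Entries pushed during the run are at least `L` and hence fixed by `φ`, so relabelling affects
-- only what comes from the initial stack.
run-map : ∀ {L s w f t} φ → (∀ {z} → L ≤ z → φ z ≡ z) → Run L s w f t →
          Run L (map φ s) w (map φ f) (map φ t)
run-map φ fix done = done
run-map {L} {s} φ fix (zero {w} {f} {t} r) =
  subst (λ k → Run L (map φ s) (𝟎 ∷ w) (map φ f) (k ∷ map φ t))
        (trans (cong (L +_) (length-map φ f)) (sym (fix (m≤m+n L _))))
        (zero (run-map φ fix r))
run-map φ fix (one r) = one (run-map φ fix r)

run-zeros : ∀ {L s} i → Run L s (replicate i 𝟎) [] (replicate i L ++ s)
run-zeros zero = done
run-zeros {L} {s} (suc i) =
  subst (λ k → Run L s (replicate (suc i) 𝟎) [] (k ∷ replicate i L ++ s))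
        (+-identityʳ L) (zero (run-zeros i))

run-ones : ∀ {L s w f t} → Run L s w f t → (# 𝟏) w ≡ length f
run-ones done = refl
run-ones (zero r) = run-ones r
run-ones (one r) = cong suc (run-ones r)

-- Each 𝟎 pushes one entry and each 𝟏 pops one.
run-balance : ∀ {L s w f t} → Run L s w f t → (# 𝟎) w + length s ≡ (# 𝟏) w + length t
run-balance done = refl
run-balance (zero r) = trans (cong suc (run-balance r)) (sym (+-suc _ _))
run-balance (one r) = trans (run-balance r) (+-suc _ _)

run-origin : ∀ {L s w f t} → Run L s w f t →
             All (λ z → z ∈ s ⊎ L ≤ z) f × All (λ z → z ∈ s ⊎ L ≤ z) t
run-origin done = [] , All.tabulate inj₁
run-origin (zero r) with run-origin r
... | pf , pt = pf , inj₂ (m≤m+n _ _) ∷ pt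
run-origin (one r) with run-origin r
... | pf , pz ∷ pt = pz ∷ pf , pt

run-stack-≤ : ∀ {w f t} → Run 0 [] w f t → All (_≤ length f) t
run-stack-≤ done = []
run-stack-≤ (zero r) = ≤-refl ∷ run-stack-≤ r
run-stack-≤ (one r) with _ ∷ pt ← run-stack-≤ r = All.map m≤n⇒m≤1+n pt

-- When the leftmost letter is a 𝟏, every pending 𝟎 lies to its right and does not count it.
run-stack-< : ∀ {w f t} → w ≡ [] ⊎ StartsWith 𝟏 w → Run 0 [] w f t → All (_< length f) t
run-stack-< (inj₁ refl) done = []
run-stack-< (inj₂ (_ , refl)) (one r) with _ ∷ pt ← run-stack-≤ r = All.map s≤s pt

#-++ : ∀ l u v → (# l) (u ++ v) ≡ (# l) u + (# l) v
#-++ l u v = trans (cong length (filter-++ (l Defs.≟_) u v)) (length-++ (filter (l Defs.≟_) u))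

-- Meeting a 𝟏 with an empty stack would, by `run-balance`, give the suffix starting there one 𝟏 too
-- many.
run-exists : ∀ L w → (∀ a b → w ≡ a ++ b → (# 𝟏) b ≤ (# 𝟎) b) → ∃₂ λ f t → Run L [] w f t
run-exists L [] _ = [] , [] , done
run-exists L (l ∷ w) suf with run-exists L w (λ a b eq → suf (l ∷ a) b (cong (l ∷_) eq))
run-exists L (𝟎 ∷ w) suf | f , t , r = f , _ , zero r
run-exists L (𝟏 ∷ w) suf | f , z ∷ t , r = z ∷ f , t , one r
run-exists L (𝟏 ∷ w) suf | f , [] , r = contradiction
  (subst ((# 𝟏) (𝟏 ∷ w) ≤_) (trans (sym (+-identityʳ _)) (trans (run-balance r) (+-identityʳ _)))
         (suf [] _ refl))
  1+n≰n

-- The leftmost letter can be read off: after a 𝟎 the top of the stack is `length f`, after a 𝟏 all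
-- pending entries are smaller.
run-injective : ∀ {w w′ f t} → Run 0 [] w f t → Run 0 [] w′ f t → w ≡ w′
run-injective done done = refl
run-injective (zero r) (zero r′) = cong (𝟎 ∷_) (run-injective r r′)
run-injective (one r) (one r′) = cong (𝟏 ∷_) (run-injective r r′)
run-injective (zero r) (one r′) with _ ∷ le ∷ _ ← run-stack-≤ r′ = contradiction le 1+n≰n
run-injective (one r) (zero r′) with _ ∷ le ∷ _ ← run-stack-≤ r = contradiction le 1+n≰n

-- y can still be popped by a letter 𝟏 preceding the suffix coded by f.
Fits : List ℕ → ℕ → Set
Fits f y = y ≤ length f × (∀ {s} → y ≤ s → y ≤ at f s)

at-old : ∀ {z f s} → s < length f → at f s ≡ at (z ∷ f) s
at-old {z} {f} s<len = sym (at-tail {z} {f} (<⇒≢ s<len))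

-- The induction carries along invariants of the stack. When the top `z` is popped, `Fits` yields
-- nesting at the new index, and sortedness (`y ≤ z`) keeps the remaining entries fitting.
run-isCode : ∀ {w f t} → Run 0 [] w f t → IsCode (at f) × All (Fits f) t × AllPairs _≥_ t
run-isCode done = record { bounded = λ _ → ≤-refl ; nested = λ s<r r≤s → r≤s } , [] , []
run-isCode (zero {f = f} r) with run-isCode r
... | c , fits , sorted = c
    , (≤-refl , λ len≤s → subst (length f ≤_) (sym (at-beyond f len≤s)) len≤s) ∷ fits
    , All.map proj₁ fits ∷ sorted
run-isCode (one {f = f} {t} {z} r) with run-isCode r
... | c , (z≤len , z-fits) ∷ fits , z≥t ∷ sorted = code , All.zipWith fits′ (fits , z≥t) , sorted
  where
  code : IsCode (at (z ∷ f))
  code .bounded r with r ≟ length f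
  ... | yes refl = z≤len
  ... | no _ = bounded c r
  code .nested {r} {s} s<r ar≤s with r ≟ length f | s ≟ length f
  ... | yes refl | yes refl = ≤-refl
  ... | yes refl | no _ = z-fits ar≤s
  ... | no _ | no _ = nested c s<r ar≤s
  ... | no _ | yes refl =
    contradiction (≤-trans s<r (subst (_≤ s) (at-beyond f (<⇒≤ s<r)) ar≤s)) 1+n≰n
  fits′ : ∀ {y} → Fits f y × z ≥ y → Fits (z ∷ f) y
  fits′ {y} ((y≤len , y-fits) , y≤z) = m≤n⇒m≤1+n y≤len , fit
    where
    fit : ∀ {s} → y ≤ s → y ≤ at (z ∷ f) s
    fit {s} y≤s with s ≟ length f
    ... | yes _ = y≤z
    ... | no _ = y-fits y≤s

mutual
  -- The run is undone from its last step. A top entry `length f` stems from a 𝟎; otherwise all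
  -- pending entries are smaller, and a 𝟏 has popped the head of `f`, which returns to the stack.
  decode : ∀ f t → IsCode (at f) → All (Fits f) t → AllPairs _≥_ t → ∃[ w ] Run 0 [] w f t
  decode f [] c fits sorted = decode-one f [] c [] [] []
  decode f (y ∷ t) c (fy ∷ fits) (ge ∷ sorted) with y ≟ length f
  ... | yes refl = let w , r = decode f t c fits sorted in 𝟎 ∷ w , zero r
  ... | no y≢ = decode-one f (y ∷ t) c (fy ∷ fits) (ge ∷ sorted)
                  (y<len ∷ All.map (λ le → ≤-<-trans le y<len) ge)
    where y<len = ≤∧≢⇒< (proj₁ fy) y≢

  decode-one : ∀ f t → IsCode (at f) → All (Fits f) t → AllPairs _≥_ t → All (_< length f) t →
                 ∃[ w ] Run 0 [] w f t
  decode-one [] [] _ _ _ _ = [] , done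
  decode-one [] (_ ∷ _) _ _ _ (() ∷ _)
  decode-one (z ∷ f) t c fits sorted lt =
    let w , r = decode f (z ∷ t) c′
                  (z-fits ∷ All.zipWith fits′ (fits , lt)) (All.map top fits⁺ ∷ sorted)
    in 𝟏 ∷ w , one r
    where
    fits⁺ = All.zip (fits , lt)
    z≡ : at (z ∷ f) (length f) ≡ z
    z≡ = at-head z f
    -- `y` fits at the index `length f`, whose value is `z`; so the stack stays sorted when `z` is
    -- pushed back.
    top : ∀ {y} → Fits (z ∷ f) y × y < suc (length f) → z ≥ y
    top {y} ((_ , y-fits) , y<) = subst (y ≤_) z≡ (y-fits (s≤s⁻¹ y<))
    fits′ : ∀ {y} → Fits (z ∷ f) y × y < suc (length f) → Fits f y
    fits′ {y} ((_ , y-fits) , y<) = s≤s⁻¹ y< , fit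
      where
      fit : ∀ {s} → y ≤ s → y ≤ at f s
      fit {s} y≤s with s <? length f
      ... | yes s<len = subst (y ≤_) (sym (at-old s<len)) (y-fits y≤s)
      ... | no s≮len = subst (y ≤_) (sym (at-beyond f (≮⇒≥ s≮len))) y≤s
    z≤len : z ≤ length f
    z≤len = subst (_≤ length f) z≡ (bounded c (length f))
    z-fits : Fits f z
    z-fits = z≤len , fit
      where
      fit : ∀ {s} → z ≤ s → z ≤ at f s
      fit {s} z≤s with s <? length f
      ... | yes s<len = subst₂ _≤_ z≡ (sym (at-old s<len))
                          (nested c s<len (subst (_≤ s) (sym z≡) z≤s))
      ... | no s≮len = subst (z ≤_) (sym (at-beyond f (≮⇒≥ s≮len))) z≤s
    c′ : IsCode (at f)
    c′ .bounded r with r <? length f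
    ... | yes r<len = subst (_≤ r) (sym (at-old r<len)) (bounded c r)
    ... | no r≮len = ≤-reflexive (at-beyond f (≮⇒≥ r≮len))
    c′ .nested {r} {s} s<r ar≤s with r <? length f
    ... | yes r<len = subst₂ _≤_ (sym (at-old r<len)) (sym (at-old (<-trans s<r r<len)))
                        (nested c s<r (subst (_≤ s) (at-old r<len) ar≤s))
    ... | no r≮len = contradiction
                       (≤-trans s<r (subst (_≤ s) (at-beyond f (≮⇒≥ r≮len)) ar≤s)) 1+n≰n

-- Dyck paths and arches

inits-All⁺ : ∀ {P : Word → Set} w → (∀ u v → w ≡ u ++ v → P u) → All P (inits w)
inits-All⁺ [] p = p [] [] refl ∷ []
inits-All⁺ (l ∷ w) p = p [] _ refl ∷ map⁺ (inits-All⁺ w λ u v eq → p (l ∷ u) v (cong (l ∷_) eq))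

inits-All⁻ : ∀ {P : Word → Set} u {v} → All P (inits (u ++ v)) → P u
inits-All⁻ [] {[]} (p ∷ _) = p
inits-All⁻ [] {_ ∷ _} (p ∷ _) = p
inits-All⁻ {P} (l ∷ u) {v} (_ ∷ ps) = inits-All⁻ {P ∘ (l ∷_)} u (map⁻ {xs = inits (u ++ v)} ps)

run-dyck : ∀ {n w f} → length f ≡ n → Run 0 [] w f [] → DyckPath n
run-dyck {n} {w} {f} len r =
  dyckPath w (trans (run-ones r) len) (trans #0≡len len) (inits-All⁺ w prefix)
  where
  #0≡len : (# 𝟎) w ≡ length f
  #0≡len = trans (sym (+-identityʳ _)) (trans (run-balance r) (trans (+-identityʳ _) (run-ones r)))
  prefix : ∀ u v → w ≡ u ++ v → (# 𝟎) u ≤ (# 𝟏) u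
  prefix u v refl with run-split u r
  ... | _ , _ , t , _ , _ , ru =
    m+n≤o⇒m≤o ((# 𝟎) u) (≤-reflexive (trans (run-balance ru) (+-identityʳ _)))

-- Turns prefix conditions into suffix conditions: `a`, `b` count the 𝟎's of a prefix and its
-- suffix, `c`, `d` their 𝟏's.
complement-≤ : ∀ {a b c d} → a + b ≡ c + d → a ≤ c → d ≤ b
complement-≤ {a} {b} {c} {d} eq a≤c =
  +-cancelˡ-≤ a d b (≤-trans (+-monoˡ-≤ d a≤c) (≤-reflexive (sym eq)))

complement-< : ∀ {a b c d} → a + b ≡ c + d → a < c → d < b
complement-< {a} {b} {c} {d} eq a<c =
  +-cancelˡ-< a d b (<-≤-trans (+-monoˡ-< d a<c) (≤-reflexive (sym eq)))

dyck-run : ∀ {n} (w : DyckPath n) → ∃[ f ] Run 0 [] (word w) f []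
dyck-run w@(dyckPath x ones zeros prefixes) with run-exists 0 x suffix
  where
  suffix : ∀ a b → x ≡ a ++ b → (# 𝟏) b ≤ (# 𝟎) b
  suffix a b refl = complement-≤
    (trans (sym (#-++ 𝟎 a b)) (trans zeros (trans (sym ones) (#-++ 𝟏 a b))))
    (inits-All⁻ a prefixes)
... | f , [] , r = f , r
... | f , z ∷ t , r = contradiction
      (+-cancelˡ-≡ ((# 𝟎) x) 0 (suc (length t))
        (trans (run-balance r) (cong (_+ suc (length t)) (trans ones (sym zeros)))))
      λ ()

-- A prime Dyck word: the conditions on a subpath, freed from its surroundings and from integer
-- heights.
record Arch (x : Word) : Set where
  field
    nonEmpty : x ≢ []
    balanced : (# 𝟎) x ≡ (# 𝟏) x
    positive : ∀ y z → x ≡ y ++ z → y ≢ [] → z ≢ [] → (# 𝟎) y < (# 𝟏) y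

height-++ : ∀ p y → height (p ++ y) ≡ height p ℤ.+ height y
height-++ p y rewrite #-++ 𝟏 p y | #-++ 𝟎 p y = ⊖-+ ((# 𝟏) p) ((# 𝟎) p) ((# 𝟏) y) ((# 𝟎) y)
  where
  ⊖-+ : ∀ a b c d → (a + c) ⊖ (b + d) ≡ (a ⊖ b) ℤ.+ (c ⊖ d)
  rearrange : ∀ i j k l → (i ℤ.+ k) ℤ.- (j ℤ.+ l) ≡ (i ℤ.- j) ℤ.+ (k ℤ.- l)
  rearrange = solve-∀
  ⊖-+ a b c d = trans (sym (ℤ.m-n≡m⊖n (a + c) (b + d)))
    (trans (rearrange (ℤ.+ a) (ℤ.+ b) (ℤ.+ c) (ℤ.+ d))
           (cong₂ ℤ._+_ (ℤ.m-n≡m⊖n a b) (ℤ.m-n≡m⊖n c d)))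

⊖-≡0 : ∀ m n → m ⊖ n ≡ 0ℤ → m ≡ n
⊖-≡0 m n eq = ℤ.+-injective (ℤ.i-j≡0⇒i≡j (ℤ.+ m) (ℤ.+ n) (trans (ℤ.m-n≡m⊖n m n) eq))

⊖-positive⁻ : ∀ m n → 0ℤ ℤ.< m ⊖ n → n < m
⊖-positive⁻ m n 0<m⊖n with n <? m
... | yes n<m = n<m
... | no n≮m = contradiction (subst (0ℤ ℤ.<_) (ℤ.⊖-≤ (≮⇒≥ n≮m)) 0<m⊖n)
                 (ℤ.≤⇒≯ (ℤ.neg-mono-≤ (ℤ.+≤+ z≤n)))

⊖-positive⁺ : ∀ {m n} → n < m → 0ℤ ℤ.< m ⊖ n
⊖-positive⁺ n<m = subst (0ℤ ℤ.<_) (sym (ℤ.⊖-≥ (<⇒≤ n<m))) (ℤ.+<+ (m<n⇒0<n∸m n<m))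

+-cancelˡ-<ℤ : ∀ i {j k} → i ℤ.+ j ℤ.< i ℤ.+ k → j ℤ.< k
+-cancelˡ-<ℤ i lt = ℤ.≰⇒> λ k≤j → ℤ.<⇒≱ lt (ℤ.+-monoʳ-≤ i k≤j)

subpath-arch : ∀ {w p x s} → Subpath w p x s → Arch x
subpath-arch {p = p} {x} sub = record
  { nonEmpty = Subpath.nonEmpty sub
  ; balanced = sym (⊖-≡0 _ _ (∙-cancelˡ (height p) _ _
      (trans (sym (height-++ p x)) (trans (Subpath.returns sub) (sym (ℤ.+-identityʳ _))))))
  ; positive = λ y z eq y≢[] z≢[] → ⊖-positive⁻ _ _ (+-cancelˡ-<ℤ (height p)
      (subst₂ ℤ._<_ (sym (ℤ.+-identityʳ _)) (height-++ p y) (Subpath.above sub eq y≢[] z≢[])))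
  }

arch-subpath : ∀ {w p x s} → w ≡ p ++ x ++ s → Arch x → Subpath w p x s
arch-subpath {p = p} {x} eq arch = record
  { factor   = eq
  ; nonEmpty = Arch.nonEmpty arch
  ; returns  = trans (height-++ p x) (trans (cong (λ i → height p ℤ.+ i)
      (trans (cong (_⊖ (# 𝟎) x) (sym (Arch.balanced arch))) (ℤ.n⊖n≡0 ((# 𝟎) x)))) (ℤ.+-identityʳ _))
  ; above    = λ {y} {z} eq y≢[] z≢[] → subst₂ ℤ._<_ (ℤ.+-identityʳ _) (sym (height-++ p y))
      (ℤ.+-monoʳ-< (height p) (⊖-positive⁺ (Arch.positive arch y z eq y≢[] z≢[])))
  }

-- The bottom of the stack is pushed by the last letter of the word.
run-bottom : ∀ {L l w f t} → (∀ a b → l ∷ w ≡ a ++ b → b ≢ [] → (# 𝟏) b < (# 𝟎) b) →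
             Run L [] (l ∷ w) f t → ∃[ t′ ] t ≡ t′ ∷ʳ L
run-bottom {L} _ (zero done) = [] , cong (_∷ []) (+-identityʳ L)
run-bottom suf (zero {_ ∷ _} r)
  with t′ , refl ← run-bottom (λ a b eq → suf (𝟎 ∷ a) b (cong (𝟎 ∷_) eq)) r = _ ∷ t′ , refl
run-bottom suf (one {w@(_ ∷ _)} r) with run-bottom (λ a b eq → suf (𝟏 ∷ a) b (cong (𝟏 ∷_) eq)) r
... | _ ∷ t′ , refl = t′ , refl
... | [] , refl = contradiction
      (subst ((# 𝟏) (𝟏 ∷ w) <_)
        (trans (sym (+-identityʳ ((# 𝟎) w))) (trans (run-balance r) (+-comm ((# 𝟏) w) 1)))
        (suf [] _ refl λ ()))
      1+n≰n

-- The opening 𝟏 matches the closing 𝟎, which has only the `L` earlier letters 𝟏 to its right; hence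
-- the head `L`.
arch-run : ∀ {x} → Arch x → ∀ L → ∃[ f ] Run L [] x (L ∷ f) []
arch-run {x} arch L with run-exists L x suffix
  where
  suffix : ∀ a b → x ≡ a ++ b → (# 𝟏) b ≤ (# 𝟎) b
  suffix [] _ refl = ≤-reflexive (sym (Arch.balanced arch))
  suffix (_ ∷ _) [] _ = z≤n
  suffix a@(_ ∷ _) b@(_ ∷ _) refl = <⇒≤ (complement-<
    (trans (sym (#-++ 𝟎 a b)) (trans (Arch.balanced arch) (#-++ 𝟏 a b)))
    (Arch.positive arch a b refl (λ ()) λ ()))
... | f , _ ∷ t , r = contradiction
      (+-cancelˡ-≡ ((# 𝟎) x) 0 (suc (length t))
        (trans (run-balance r) (cong (_+ suc (length t)) (sym (Arch.balanced arch)))))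
      λ ()
... | [] , [] , done = contradiction refl (Arch.nonEmpty arch)
... | z ∷ f , [] , one {l ∷ w} r with run-bottom suffix r
  where
  suffix : ∀ a b → l ∷ w ≡ a ++ b → b ≢ [] → (# 𝟏) b < (# 𝟎) b
  suffix a b eq b≢[] = complement-<
    (trans (sym (#-++ 𝟎 (𝟏 ∷ a) b)) (trans (cong (λ y → (# 𝟎) (𝟏 ∷ y)) (sym eq))
      (trans (Arch.balanced arch) (trans (cong (λ y → (# 𝟏) (𝟏 ∷ y)) eq) (#-++ 𝟏 (𝟏 ∷ a) b)))))
    (Arch.positive arch (𝟏 ∷ a) b (cong (𝟏 ∷_) eq) (λ ()) b≢[])
...   | [] , refl = f , one r
...   | _ ∷ [] , ()
...   | _ ∷ _ ∷ _ , ()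

-- If the stack were empty between `y` and `z`, the opening 𝟏 would pop an entry pushed inside `y`,
-- whose value exceeds `L`.
run-arch : ∀ {L x f} → Run L [] x (L ∷ f) [] → Arch x
run-arch {L} {x} {f} r = record
  { nonEmpty = λ { refl → case r of λ () }
  ; balanced = trans (sym (+-identityʳ _)) (trans (run-balance r) (+-identityʳ _))
  ; positive = positive
  }
  where
  positive : ∀ y z → x ≡ y ++ z → y ≢ [] → z ≢ [] → (# 𝟎) y < (# 𝟏) y
  positive [] _ _ y≢[] _ = contradiction refl y≢[]
  positive y@(_ ∷ _) z refl _ z≢[] with run-split y r
  ... | _ , g , _ ∷ t , _ , _ , ry = m+n≤o⇒m≤o (suc ((# 𝟎) y))
        (≤-reflexive (trans (sym (+-suc _ (length t))) (trans (run-balance ry) (+-identityʳ _))))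
  ... | [] , g , [] , _ , _ , ()
  ... | _ ∷ _ , [] , [] , _ , done , _ = contradiction refl z≢[]
  ... | _ ∷ _ , _ ∷ _ , [] , refl , _ , ry with proj₁ (run-origin ry)
  ...   | inj₂ le ∷ _ = contradiction (m+n≤o⇒m≤o (suc L) (subst (_≤ L) (+-suc L _) le)) 1+n≰n

-- Edges

redirect : ℕ → ℕ → ℕ → ℕ
redirect m k z with z ≟ m
... | yes _ = k
... | no  _ = z

redirect-hit : ∀ m k → redirect m k m ≡ k
redirect-hit m k with m ≟ m
... | yes _ = refl
... | no ≢ = contradiction refl ≢

redirect-miss : ∀ {m k z} → z ≢ m → redirect m k z ≡ z
redirect-miss {m} {k} {z} ≢ with z ≟ m
... | yes e = contradiction e ≢
... | no _ = refl

replicate-++ : ∀ {A : Set} m n {x : A} → replicate (m + n) x ≡ replicate m x ++ replicate n x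
replicate-++ zero n = refl
replicate-++ (suc m) n = cong (_ ∷_) (replicate-++ m n)

-- If a does not end with 𝟎, every 𝟎 of a lies left of a 𝟏 of a and is
-- therefore recorded with a value above L.
run-map-strict : ∀ {L s f t} a φ → ¬ EndsWith 𝟎 a → (∀ {z} → L < z → φ z ≡ z) → Run L s a f t →
                 Run L (map φ s) a (map φ f) (map φ t)
run-map-strict a φ ¬0 fix r with initLast a
run-map-strict _ φ ¬0 fix done | [] = done
... | a′ ∷ʳ′ 𝟎 = contradiction (a′ , refl) ¬0
... | a′ ∷ʳ′ 𝟏 with run-split a′ r
...   | f , _ , t , refl , one done , ra =
        subst (λ h → Run _ _ (a′ ∷ʳ 𝟏) h _) (sym (map-++ φ f _))
          (run-++ (one done) (run-map φ (λ {z} lt → fix (subst (_≤ z) (+-comm _ 1) lt)) ra))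

-- The `i` letters 𝟎 that recorded `m` now record `L`. Entries of `s` are smaller than `m` and
-- entries from `L` on are larger, so `redirect m L` changes no others.
run-redirect : ∀ {a M i m L s f} → ¬ EndsWith 𝟎 a → m < L → All (_< m) s →
               Run L (replicate M L ++ replicate i m ++ s) a f [] →
               Run L (replicate (M + i) L ++ s) a (map (redirect m L) f) []
run-redirect {a} {M} {i} {m} {L} {s} ¬0 m<L s<m r =
  subst (λ t → Run L t a _ []) stack
    (run-map-strict a φ ¬0 (λ L<z → redirect-miss (>⇒≢ (<-trans m<L L<z))) r)
  where
  open ≡-Reasoning
  φ = redirect m L
  stack : map φ (replicate M L ++ replicate i m ++ s) ≡ replicate (M + i) L ++ s
  stack = begin
    map φ (replicate M L ++ replicate i m ++ s)
      ≡⟨ trans (map-++ φ (replicate M L) _)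
           (cong (map φ (replicate M L) ++_) (map-++ φ (replicate i m) s)) ⟩
    map φ (replicate M L) ++ map φ (replicate i m) ++ map φ s
      ≡⟨ cong₂ _++_ (trans (map-replicate φ M L) (cong (replicate M) (redirect-miss (>⇒≢ m<L))))
           (cong₂ _++_ (trans (map-replicate φ i m) (cong (replicate i) (redirect-hit m L)))
             (map-id-local (All.map (redirect-miss ∘ <⇒≢) s<m))) ⟩
    replicate M L ++ replicate i L ++ s
      ≡⟨ ++-assoc (replicate M L) _ s ⟨
    (replicate M L ++ replicate i L) ++ s
      ≡⟨ cong (_++ s) (replicate-++ M i) ⟨
    replicate (M + i) L ++ s ∎

-- `as` holds the entries of index above `length bs`, and `z ≤ length bs` keeps `z` apart from the
-- default values beyond the list.
redirect-drop : ∀ {z} as bs → z ≤ length bs →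
                Drop (length bs) (at (as ++ z ∷ bs))
                  (at (map (redirect z (suc (length bs))) as ++ z ∷ bs))
redirect-drop {z} as bs z≤len = record { linked-ups = hit ; other-ups = miss }
  where
  u = at (as ++ z ∷ bs)
  φ = redirect z (suc (length bs))
  uq≡z : u (length bs) ≡ z
  uq≡z = trans (at-++ as ≤-refl) (at-head z bs)
  moved : ∀ {r} → length bs < r → at (map φ as ++ z ∷ bs) r ≡ φ (u r)
  moved = at-map φ as (λ len<z → redirect-miss (>⇒≢ (≤-<-trans z≤len len<z)))
  hit : ∀ {r} → length bs < r → u r ≡ u (length bs) → at (map φ as ++ z ∷ bs) r ≡ suc (length bs)
  hit lt e = trans (moved lt) (trans (cong φ (trans e uq≡z)) (redirect-hit z _))
  miss : ∀ {r} → ¬ (length bs < r × u r ≡ u (length bs)) → at (map φ as ++ z ∷ bs) r ≡ u r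
  miss {r} ¬a with length bs <? r
  ... | yes lt = trans (moved lt) (redirect-miss λ e → ¬a (lt , trans e (sym uq≡z)))
  ... | no ≮ = trans (at-++ (map φ as) (s≤s (≮⇒≥ ≮))) (sym (at-++ as (s≤s (≮⇒≥ ≮))))

module _ {a x b : Word} {gs bs s : List ℕ} {M i : ℕ}
  (¬0 : ¬ EndsWith 𝟎 a)
  (rb : Run 0 [] b bs s) (followed : b ≡ [] ⊎ StartsWith 𝟏 b)
  (rx : Run (length bs) [] x (length bs ∷ gs) [])
  where

  private
    m = length bs
    -- The value recorded by a 𝟎 just left of `x`. The opening 𝟏 of `x` has index
    -- `q = length (gs ++ bs)`, so this is the value `suc q` of a drop at `q`.
    L = suc (length (gs ++ bs))

  -- The target of an edge: the `i` letters 𝟎 right of `x` record `m`, the `M` letters left of it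
  -- record `L`.
  upper-run : ∀ {f} → Run 0 [] (a ++ replicate M 𝟎 ++ x ++ replicate i 𝟎 ++ b) f [] →
               ∃[ as ] f ≡ as ++ m ∷ gs ++ bs × Run L (replicate M L ++ replicate i m ++ s) a as []
  upper-run r
    with as , _ , t₁ , refl , r₁ , ra ← run-split a r
    with _ , _ , t₂ , refl , r₂ , r0 ← run-split (replicate M 𝟎) r₁
    with refl , refl ← run-deterministic r₂
           (run-++ (run-++ rb (run-zeros i)) (run-lift (replicate i m ++ s) rx))
    with refl , refl ← run-deterministic r0 (run-zeros M)
    = as , refl , ra

  -- The source of the edge: all `M + i` letters 𝟎 stand left of `x` and record `L`. By `followed`,
  -- no other pending entry equals `m`.
  lower-run : ∀ {as} → Run L (replicate M L ++ replicate i m ++ s) a as [] →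
              Run 0 [] (a ++ replicate (M + i) 𝟎 ++ x ++ b)
                    (map (redirect m L) as ++ m ∷ gs ++ bs) []
  lower-run ra = run-++ (run-++ (run-++ rb (run-lift s rx)) (run-zeros (M + i)))
    (run-redirect {M = M} {i} ¬0 (s≤s (subst (m ≤_) (sym (length-++ gs)) (m≤n+m m _)))
      (run-stack-< followed rb) ra)

run-split-at : ∀ {L s v h t} as {z bs} → Run L s v h t → h ≡ as ++ z ∷ bs →
               ∃[ a ] ∃[ y ] ∃[ st ] v ≡ a ++ 𝟏 ∷ y × Run L s y bs (z ∷ st) ×
                 Run (L + suc (length bs)) st a as t
run-split-at [] done ()
run-split-at (_ ∷ _) done ()
run-split-at {L} {s} as {z} {bs} (zero {t = t} r) refl with run-split-at as r refl
... | a , y , st , refl , ry , ra = 𝟎 ∷ a , y , st , refl , ry ,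
      subst (λ k → Run (L + suc (length bs)) st (𝟎 ∷ a) as (k ∷ t))
            (sym (base-++ L as (z ∷ bs))) (zero ra)
run-split-at [] (one {w} {t = t} r) refl = [] , w , t , refl , r , done
run-split-at (_ ∷ as) (one r) refl with run-split-at as r refl
... | a , y , st , refl , ry , ra = 𝟏 ∷ a , y , st , refl , ry , one ra

-- Finds the 𝟎 that pushed the pending `z`. The entries `ts` above `z` vary in the induction, since
-- removing a leading 𝟏 puts its popped entry back on top.
run-match : ∀ {y bs t} ts {z st} → Run 0 [] y bs t → t ≡ ts ++ z ∷ st →
            ∃[ y₁ ] ∃[ y₂ ] ∃[ gs ] ∃[ fs ] y ≡ y₁ ++ 𝟎 ∷ y₂ × bs ≡ gs ++ fs × z ≡ length fs ×
              Run 0 [] y₂ fs st × Run (length fs) [] y₁ gs ts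
run-match [] done ()
run-match (_ ∷ _) done ()
run-match [] (zero {w} {f} r) refl = [] , w , [] , f , refl , refl , refl , r , done
run-match (_ ∷ ts) (zero r) refl with run-match ts r refl
... | y₁ , y₂ , gs , fs , refl , refl , refl , r₂ , r₁ =
      𝟎 ∷ y₁ , y₂ , gs , fs , refl , refl , refl , r₂ ,
      subst (λ k → Run _ [] (𝟎 ∷ y₁) gs (k ∷ ts)) (sym (base-++ 0 gs fs)) (zero r₁)
run-match ts (one {z = z} r) refl with run-match (z ∷ ts) r refl
... | y₁ , y₂ , gs , fs , refl , refl , refl , r₂ , r₁ =
      𝟏 ∷ y₁ , y₂ , z ∷ gs , fs , refl , refl , refl , r₂ , one r₁

run-leading-zeros : ∀ {y fs t} → Run 0 [] y fs t →
                    ∃[ i ] ∃[ b ] ∃[ s ] y ≡ replicate i 𝟎 ++ b × t ≡ replicate i (length fs) ++ s ×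
                      Run 0 [] b fs s × (b ≡ [] ⊎ StartsWith 𝟏 b)
run-leading-zeros done = 0 , [] , [] , refl , refl , done , inj₁ refl
run-leading-zeros r@(one {w} {t = t} _) = 0 , 𝟏 ∷ w , t , refl , refl , r , inj₂ (w , refl)
run-leading-zeros (zero r) with run-leading-zeros r
... | i , b , s , refl , refl , rb , followed = suc i , b , s , refl , refl , rb , followed

strip-zeros : ∀ a → ∃₂ λ a₀ M → a ≡ a₀ ++ replicate M 𝟎 × ¬ EndsWith 𝟎 a₀
strip-zeros [] = [] , 0 , refl , λ { ([] , ()) ; (_ ∷ _ , ()) }
strip-zeros (l ∷ a) with strip-zeros a
strip-zeros (𝟎 ∷ _) | [] , M , refl , ¬0 = [] , suc M , refl , ¬0
strip-zeros (𝟏 ∷ _) | [] , M , refl , ¬0 =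
  𝟏 ∷ [] , M , refl , λ { ([] , ()) ; (_ ∷ [] , ()) ; (_ ∷ _ ∷ _ , ()) }
strip-zeros (l ∷ _) | a₀@(_ ∷ _) , M , refl , ¬0 =
  l ∷ a₀ , M , refl , λ { ([] , ()) ; (_ ∷ u , eq) → ¬0 (u , ∷-injectiveʳ eq) }

zeros-endsWith : ∀ a {k} → 1 ≤ k → EndsWith 𝟎 (a ++ replicate k 𝟎)
zeros-endsWith a {suc k} _ = a ++ replicate k 𝟎 ,
  trans (cong (a ++_) (trans (cong (λ j → replicate j 𝟎) (+-comm 1 k)) (replicate-++ k 1)))
        (sym (++-assoc a (replicate k 𝟎) (𝟎 ∷ [])))

∈-replicate-++ : ∀ i {m s} → All (_< m) s → m ∈ replicate i m ++ s → 1 ≤ i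
∈-replicate-++ zero s<m m∈s = contradiction (All.lookup s<m m∈s) 1+n≰n
∈-replicate-++ (suc i) _ _ = s≤s z≤n

run-arch-around : ∀ {L y gs} → Run L [] y gs [] → Run L [] (𝟏 ∷ y ++ 𝟎 ∷ []) (L ∷ gs) []
run-arch-around {L} {y} {gs} r =
  one (subst (λ f → Run L [] (y ++ 𝟎 ∷ []) f (L ∷ [])) (++-identityʳ gs)
  (run-++ (run-zeros 1) (subst (λ k → Run k (L ∷ []) y gs (L ∷ [])) (sym (+-identityʳ L))
    (run-lift (L ∷ []) r))))

-- Codes of Dyck paths and of their edges

code : ∀ {n} → DyckPath n → List ℕ
code w = proj₁ (dyck-run w)

run-code : ∀ {n} (w : DyckPath n) → Run 0 [] (word w) (code w) []
run-code w = proj₂ (dyck-run w)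

⟦_⟧ : ∀ {n} → DyckPath n → ℕ → ℕ
⟦ w ⟧ = at (code w)

⟦⟧-isCode : ∀ {n} (w : DyckPath n) → IsCode ⟦ w ⟧
⟦⟧-isCode w = proj₁ (run-isCode (run-code w))

length-code : ∀ {n} (w : DyckPath n) → length (code w) ≡ n
length-code w = trans (sym (run-ones (run-code w))) (DyckPath.ones w)

code-unique : ∀ {n} (w : DyckPath n) {f} → Run 0 [] (word w) f [] → code w ≡ f
code-unique w r = proj₁ (run-deterministic (run-code w) r)

⟦⟧-injective : ∀ {n} (v w : DyckPath n) → (∀ r → ⟦ v ⟧ r ≡ ⟦ w ⟧ r) → v ≡ w
⟦⟧-injective v w eq = word-injective (run-injective (run-code v)
  (subst (λ f → Run 0 [] (word w) f []) (sym codes) (run-code w)))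
  where
  codes : code v ≡ code w
  codes = at-injective _ _ (trans (length-code v) (sym (length-code w))) eq

edge-⊑ : ∀ {n} {w v : DyckPath n} → w ⟶ v → ⟦ w ⟧ ⊑ ⟦ v ⟧
edge-⊑ {w = w} {v} (move {a} {x} {b} N i movable ¬0 _ i≤N v≡)
  with arch ← subpath-arch (Movable.subpath movable)
  with rw ← subst (λ y → Run 0 [] y (code w) [])
         (Subpath.factor (Movable.subpath movable)) (run-code w)
  with _ , _ , _ , _ , rxb , _ ← run-split (a ++ replicate N 𝟎) rw
  with _ , bs , s , _ , rb , _ ← run-split x rxb
  with gs , rx ← arch-run arch (length bs)
  with as , v-code , ra ← upper-run {M = N ∸ i} {i} ¬0 rb (Movable.followed movable) rx
         (subst (λ y → Run 0 [] y (code v) []) v≡ (run-code v))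
  = subst₂ (λ f g → at f ⊑ at g) (sym w-code) (sym v-code)
      (drop-⊑ (redirect-drop as (gs ++ bs) m≤) (subst (IsCode ∘ at) v-code (⟦⟧-isCode v)))
  where
  w≡ : word w ≡ a ++ replicate (N ∸ i + i) 𝟎 ++ x ++ b
  w≡ = trans (Subpath.factor (Movable.subpath movable))
         (trans (++-assoc a _ _) (cong (λ k → a ++ replicate k 𝟎 ++ x ++ b) (sym (m∸n+n≡m i≤N))))
  w-code : code w ≡ map (redirect (length bs) (suc (length (gs ++ bs)))) as ++ length bs ∷ gs ++ bs
  w-code = code-unique w (subst (λ y → Run 0 [] y _ []) (sym w≡)
             (lower-run {M = N ∸ i} {i} ¬0 rb (Movable.followed movable) rx ra))
  m≤ : length bs ≤ length (gs ++ bs)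
  m≤ = subst (length bs ≤_) (sym (length-++ gs)) (m≤n+m _ _)

≤ᴰ-⊑ : ∀ {n} {w v : DyckPath n} → w ≤ᴰ v → ⟦ w ⟧ ⊑ ⟦ v ⟧
≤ᴰ-⊑ ε = ⊑-reflexive λ _ → refl
≤ᴰ-⊑ (e ◅ es) = ⊑-trans (edge-⊑ e) (≤ᴰ-⊑ es)

-- `x` runs from the 𝟏 with entry `z` to its matching 𝟎. Moving all `i` letters 𝟎 that follow `x` to
-- its left leaves a `b` that is empty or starts with 𝟏, so `x` is movable.
lower-edge : ∀ {n} (v : DyckPath n) as {z bs} → code v ≡ as ++ z ∷ bs → z ∈ as →
             ∃[ w ] w ⟶ v × code w ≡ map (redirect z (suc (length bs))) as ++ z ∷ bs
lower-edge {n} v as {z} v-code z∈as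
  with a′ , y , st , v≡₁ , ry , ra′ ← run-split-at as (run-code v) v-code
  with y₁ , y₂ , gs , bs , refl , refl , refl , r₂ , r₁ ← run-match [] ry refl
  with i , b , s , refl , refl , rb , followed ← run-leading-zeros r₂
  with a , M , refl , ¬0 ← strip-zeros a′
  with as′ , _ , _ , as≡ , r0 , ra ← run-split a ra′
  with refl , refl ← run-deterministic r0 (run-zeros M)
  with refl ← trans as≡ (++-identityʳ as′)
  = w , move (M + i) i movable ¬0 1≤i (m≤n+m i M) v≡ , w-code
  where
  x = 𝟏 ∷ y₁ ++ 𝟎 ∷ []
  L = suc (length (gs ++ bs))
  rx = run-arch-around r₁
  ra₀ : Run L (replicate M L ++ replicate i (length bs) ++ s) a as′ []
  ra₀ = subst (λ k → Run k (replicate M L ++ replicate i (length bs) ++ s) a as′ [])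
          (+-identityʳ L) ra
  rw = lower-run {M = M} {i} ¬0 rb followed rx ra₀
  w : DyckPath n
  w = run-dyck (trans (length-map-++ _ as′ _) (trans (cong length (sym v-code)) (length-code v))) rw
  w-code = code-unique w rw
  v≡ : word v ≡ a ++ replicate (M + i ∸ i) 𝟎 ++ x ++ replicate i 𝟎 ++ b
  v≡ = trans v≡₁ (trans (++-assoc a (replicate M 𝟎) _)
         (cong₂ (λ k u → a ++ replicate k 𝟎 ++ 𝟏 ∷ u) (sym (m+n∸n≡m M i))
           (sym (++-assoc y₁ (𝟎 ∷ []) _))))
  1≤i : 1 ≤ i
  -- Entries pushed within `a′` exceed `z`, so the `z` popped there was already pending; among those
  -- entries only the letters 𝟎 right behind `x` record `z`.
  1≤i with All.lookup (proj₁ (run-origin ra′)) z∈as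
  ... | inj₂ le =
    contradiction (≤-trans le (subst (length bs ≤_) (sym (length-++ gs)) (m≤n+m _ _))) 1+n≰n
  ... | inj₁ z∈st = ∈-replicate-++ i (run-stack-< followed rb) z∈st
  movable : Movable (word w) (a ++ replicate (M + i) 𝟎) x b
  movable = record
    { subpath  = arch-subpath (sym (++-assoc a _ _)) (run-arch rx)
    ; preceded = zeros-endsWith a (≤-trans 1≤i (m≤n+m i M))
    ; followed = followed
    }

-- The dexter order through codes

⟦⟧-beyond : ∀ {n} (w : DyckPath n) {r} → n ≤ r → ⟦ w ⟧ r ≡ r
⟦⟧-beyond w n≤r = at-beyond (code w) (subst (_≤ _) (sym (length-code w)) n≤r)

-- Termination measure for the descent towards `w`: the total distance still to be covered at
-- indices below `n`.
gap : ℕ → (w u : ℕ → ℕ) → ℕ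
gap zero    w u = 0
gap (suc n) w u = w n ∸ u n + gap n w u

gap-antitone : ∀ n {w u u′} → (∀ r → u r ≤ u′ r) → gap n w u′ ≤ gap n w u
gap-antitone zero    le = z≤n
gap-antitone (suc n) {w} le = +-mono-≤ (∸-monoʳ-≤ (w n) (le n)) (gap-antitone n le)

gap-decreases : ∀ n {w u u′ r} → (∀ s → u s ≤ u′ s) → r < n → u r < u′ r → u′ r ≤ w r →
                gap n w u′ < gap n w u
gap-decreases (suc n) {w} le r<1+n u<u′ u′≤w with m≤n⇒m<n∨m≡n (s≤s⁻¹ r<1+n)
... | inj₁ r<n = +-mono-≤-< (∸-monoʳ-≤ (w n) (le n)) (gap-decreases n le r<n u<u′ u′≤w)
... | inj₂ refl = +-mono-<-≤ (∸-monoʳ-< u<u′ u′≤w) (gap-antitone n le)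

⊑-≤ᴰ : ∀ {n} {w v : DyckPath n} → ⟦ w ⟧ ⊑ ⟦ v ⟧ → w ≤ᴰ v
⊑-≤ᴰ {n} {w} {v} = go v (<-wellFounded _)
  where
  go : ∀ v → Acc _<_ (gap n ⟦ w ⟧ ⟦ v ⟧) → ⟦ w ⟧ ⊑ ⟦ v ⟧ → w ≤ᴰ v
  go v (acc rec) w⊑v with minimal? (λ r → ⟦ v ⟧ r <? ⟦ w ⟧ r) n
  ... | inj₂ none = subst (w ≤ᴰ_) (⟦⟧-injective w v eq) ε
    where
    eq : ∀ r → ⟦ w ⟧ r ≡ ⟦ v ⟧ r
    eq r with r <? n
    ... | yes r<n = ≤-antisym (≮⇒≥ (none r<n)) (below w⊑v r)
    ... | no r≮n = trans (⟦⟧-beyond w (≮⇒≥ r≮n)) (sym (⟦⟧-beyond v (≮⇒≥ r≮n)))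
  ... | inj₁ (r , r<n , v<w , least) = step
    where
    cw = ⟦⟧-isCode w
    cv = ⟦⟧-isCode v
    agree : ∀ {s} → s < r → ⟦ w ⟧ s ≡ ⟦ v ⟧ s
    agree s<r = ≤-antisym (≮⇒≥ (least s<r)) (below w⊑v _)
    q = pivot cw cv w⊑v agree v<w
    q<r : q < r
    q<r = pivot<r cw cv w⊑v agree v<w
    vr≡vq : ⟦ v ⟧ r ≡ ⟦ v ⟧ q
    vr≡vq = pivot-linked cw cv w⊑v agree v<w
    r<len : r < length (code v)
    r<len = subst (r <_) (sym (length-code v)) r<n
    step : w ≤ᴰ v
    step
      -- The value at the pivot recurs at `r`, which lies further left in the list; this is the
      -- hypothesis of `lower-edge`.
      with as , bs , v-code , len ← at-split (code v) (<-trans q<r r<len)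
      with v′ , e , v′-code ← lower-edge v as v-code
             (subst (_∈ as) (trans (cong (λ f → at f r) (sym v-code)) vr≡vq)
               (at-∈ as (subst (λ k → suc k ≤ r) (sym len) q<r)
                        (subst (λ f → r < length f) v-code r<len)))
      = go v′ (rec (gap-decreases n (below (edge-⊑ e)) r<n
            (subst (⟦ v ⟧ r <_) (sym (Drop.linked-ups d q<r vr≡vq))
              (subst (_< suc q) (sym vr≡vq) (s≤s (bounded cv q))))
            (below w⊑v′ r)))
          w⊑v′ ◅◅ (e ◅ ε)
      where
      z = ⟦ v ⟧ q
      d : Drop q ⟦ v ⟧ ⟦ v′ ⟧
      d = subst₂ (Drop q) (cong at (sym v-code)) (cong at (sym v′-code))
            (subst (λ k → Drop k (at (as ++ z ∷ bs))
                                 (at (map (redirect z (suc (length bs))) as ++ z ∷ bs))) len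
              (redirect-drop as bs (subst (⟦ v ⟧ q ≤_) (sym len) (bounded cv q))))
      w⊑v′ : ⟦ w ⟧ ⊑ ⟦ v′ ⟧
      w⊑v′ = drop-lower cw cv w⊑v agree v<w d

-- The semilattice structure

≤ᴰ-antisym : ∀ {n} {v w : DyckPath n} → v ≤ᴰ w → w ≤ᴰ v → v ≡ w
≤ᴰ-antisym {v = v} {w} p q = ⟦⟧-injective v w (⊑-antisym (≤ᴰ-⊑ p) (≤ᴰ-⊑ q))

meet : ∀ {n} (u v : DyckPath n) →
       ∃[ m ] m ≤ᴰ u × m ≤ᴰ v × (∀ w → w ≤ᴰ u → w ≤ᴰ v → w ≤ᴰ m)
meet {n} u v = m , ⊑-≤ᴰ (as-m (_⊑ ⟦ u ⟧) G.⊑-left) , ⊑-≤ᴰ (as-m (_⊑ ⟦ v ⟧) G.⊑-right) ,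
  λ w w≤u w≤v → ⊑-≤ᴰ (as-m (⟦ w ⟧ ⊑_) (G.greatest (≤ᴰ-⊑ w≤u) (≤ᴰ-⊑ w≤v) (⟦⟧-isCode w)))
  where
  f = greedy (⟦⟧-isCode u) (⟦⟧-isCode v) n
  module G = Greedy (⟦⟧-isCode u) (⟦⟧-isCode v)
               (greedy-isGreedy (⟦⟧-isCode u) (⟦⟧-isCode v) n (⟦⟧-beyond u))
  -- The empty final stack means that every 𝟎 is matched, so the decoded word is a Dyck path.
  f-run = decode f [] G.isCode [] []
  m : DyckPath n
  m = run-dyck (length-greedy (⟦⟧-isCode u) (⟦⟧-isCode v) n) (proj₂ f-run)
  as-m : ∀ (P : (ℕ → ℕ) → Set) → P (at f) → P ⟦ m ⟧
  as-m P = subst (λ g → P (at g)) (sym (code-unique m (proj₂ f-run)))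

theorem7p6 : ∀ (n : ℕ) → ∃ λ _∧_ → IsMeetSemilattice {A = DyckPath n} _≡_ _≤ᴰ_ _∧_
theorem7p6 n = (λ u v → proj₁ (meet u v)) , record
  { isPartialOrder = record
      { isPreorder = record
          { isEquivalence = isEquivalence
          ; reflexive     = λ { refl → ε }
          ; trans         = _◅◅_
          }
      ; antisym = ≤ᴰ-antisym
      }
  ; infimum = λ u v → proj₂ (meet u v)
  }
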